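{- Let $p>5$ be a (rational integer) prime, let $i^2=-1$, and for each integer $k\geq 1$ define $$S_p^{(k)} = \sum_{\substack{1\leq n,m\leq p-1\\ \gcd(p,\,m^2+n^2)=1}} \frac{1}{(n+mi)^k},$$ where the sum is over all pairs of integers $(n,m)$ with $1\le n,m\le p-1$ and $m^2+n^2$ not divisible by $p$. Then the following congruences hold: (1) $S_p^{(1)} \equiv 0 \pmod{p^4}$; (2) $S_p^{(2)} \equiv 0 \pmod{p^3}$; (3) $S_p^{(3)} \equiv 0 \pmod{p^2}$; (4) $S_p^{(4)} \equiv 0 \pmod{p}$.
   Context: The sums are computed in $\mathbb{Q}(i)$. Every summand has denominator a power of a Gaussian integer whose norm $n^2+m^2$ is coprime to $p$, so the sums lie in the ring $R=\{a/b : a\in\mathbb{Z}[i],\ b\in\mathbb{Z},\ p\nmid b\}$. For $x,y\in R$, the congruence $x\equiv y \pmod{p^j}$ means $x-y\in p^jR$, i.e. $x-y=p^j a/b$ with $a\in\mathbb{Z}[i]$, $b\in\mathbb{Z}$, $p\nmid b$. -}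

module Defs where

open import Data.Nat.Base as ℕ using (ℕ; zero; suc; _∸_)
open import Data.Nat.GCD using (gcd)
import Data.Nat.Properties as ℕ
open import Data.Integer.Base as ℤ using (ℤ; +_)
open import Data.Integer.Divisibility using (_∣_)
open import Data.Rational.Base as ℚ using (ℚ; 0ℚ; 1ℚ)
import Data.Rational.Properties as ℚ
open import Data.Rational.Literals using (fromℤ)
open import Data.List.Base using (List; map; foldr; filter; upTo; cartesianProduct)
open import Data.Product.Base using (_×_; _,_; ∃-syntax)
open import Relation.Nullary.Decidable.Core using (yes; no)
open import Relation.Nullary.Negation.Core using (¬_)
open import Relation.Binary.PropositionalEquality.Core using (_≡_)

infix  9 _+i_
infix  9 _⁻¹
infixr 8 _^_
infixl 7 _*_ _÷_
infixl 6 _+_ _-_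

record ℤ[i] : Set where
  constructor _+i_
  field
    re im : ℤ

record ℚ[i] : Set where
  constructor _+i_
  field
    re im : ℚ

0# 1# : ℚ[i]
0# = 0ℚ +i 0ℚ
1# = 1ℚ +i 0ℚ

_+_ _-_ _*_ : ℚ[i] → ℚ[i] → ℚ[i]
(a +i b) + (c +i d) = (a ℚ.+ c) +i (b ℚ.+ d)
(a +i b) - (c +i d) = (a ℚ.- c) +i (b ℚ.- d)
(a +i b) * (c +i d) = (a ℚ.* c ℚ.- b ℚ.* d) +i (a ℚ.* d ℚ.+ b ℚ.* c)

_^_ : ℚ[i] → ℕ → ℚ[i]
z ^ zero  = 1#
z ^ suc k = z * z ^ k

norm : ℚ[i] → ℚ
norm (a +i b) = a ℚ.* a ℚ.+ b ℚ.* b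

-- Total inverse: z⁻¹ = z̄ / N(z) for z ≠ 0, with the convention 0⁻¹ = 0.
-- Below it is only applied to nonzero elements.
_⁻¹ : ℚ[i] → ℚ[i]
z@(a +i b) ⁻¹ with norm z ℚ.≟ 0ℚ
... | yes _   = 0#
... | no  N≢0 = (a ℚ.÷ norm z) +i ((ℚ.- b) ℚ.÷ norm z)
  where instance _ = ℚ.≢-nonZero N≢0

_÷_ : ℚ[i] → ℚ[i] → ℚ[i]
z ÷ w = z * w ⁻¹

fromℤ[i] : ℤ[i] → ℚ[i]
fromℤ[i] (a +i b) = fromℤ a +i fromℤ b

ι : ℤ → ℚ[i]
ι a = fromℤ[i] (a +i (+ 0))

-- The subring R of fractions a / b with a ∈ ℤ[i], b ∈ ℤ and p ∤ b.
R : ℕ → ℚ[i] → Set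
R p z = ∃[ a ] ∃[ b ] (¬ (+ p ∣ b)) × z ≡ fromℤ[i] a ÷ ι b

-- x ≡ y (mod p ^ j) in R, that is, x - y ∈ p ^ j R.
_≅_[mod_^_] : ℚ[i] → ℚ[i] → ℕ → ℕ → Set
x ≅ y [mod p ^ j ] = ∃[ r ] R p r × x - y ≡ ι (+ p) ^ j * r

indices : ℕ → List (ℕ × ℕ)
indices p = filter (λ (n , m) → gcd p (m ℕ.^ 2 ℕ.+ n ℕ.^ 2) ℕ.≟ 1)
                   (cartesianProduct [1⋯p-1] [1⋯p-1])
  where
  [1⋯p-1] : List ℕ
  [1⋯p-1] = map suc (upTo (p ∸ 1))

∑ : List ℚ[i] → ℚ[i]
∑ = foldr _+_ 0#

S : ℕ → ℕ → ℚ[i]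
S p k = ∑ (map (λ (n , m) → 1# ÷ fromℤ[i] ((+ n) +i (+ m)) ^ k) (indices p))

{-# OPTIONS --safe #-}

-- Let u = 1/z and w = 1/(p + iz), where z = n + mi. The rotation (n, m) ↦ (p - m, n)
-- permutes the index set and sends z to p + iz, so the sums of w ^ k and of u ^ k agree.
-- With y = iu one has w + y = p w y, that is, w is minus the geometric series
-- y + p y² + p² y³ + … . Expanding w ^ k for k = 3, 2, 1 and summing expresses a unit
-- (1 ± i or 2) times S^(k) through p S^(k+1), p² S^(k+2), …, so everything reduces
-- to S^(4) ≡ 0 (mod p). There, multiplying (n, m) by 2 modulo p permutes the index set,
-- whence 16 S^(4) ≡ S^(4), and 15 is a unit because p > 5.

module Submission where

open import Defs
open import Algebra.Bundles using (CommutativeRing)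
import Algebra.Solver.Ring.AlmostCommutativeRing as ACR
import Algebra.Solver.Ring.Simple as Solver
open import Algebra.Structures using (IsCommutativeRing)
open import Data.Integer.Base as ℤ using (ℤ; +_)
open import Data.Integer.Divisibility using (_∣_)
import Data.Integer.Properties as ℤ
import Data.Integer.Solver as ℤ
open import Data.List.Base using (List; []; _∷_; map; upTo; cartesianProduct)
open import Data.List.Membership.Propositional using (_∈_)
open import Data.List.Membership.Propositional.Properties
  using (∈-map⁺; ∈-map⁻; ∈-upTo⁺; ∈-upTo⁻; ∈-filter⁺; ∈-filter⁻; ∈-cartesianProduct⁺; ∈-cartesianProduct⁻)
open import Data.List.Membership.Propositional.Properties.WithK using (unique∧set⇒bag)
open import Data.List.Properties using (map-∘)
open import Data.List.Relation.Binary.BagAndSetEquality using (∼bag⇒↭)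
open import Data.List.Relation.Binary.Permutation.Propositional using (_↭_; ↭⇒↭ₛ)
open import Data.List.Relation.Binary.Permutation.Propositional.Properties using (map⁺)
open import Data.List.Relation.Binary.Permutation.Setoid.Properties using (foldr-commMonoid)
import Data.List.Relation.Unary.All as All
import Data.List.Relation.Unary.All.Properties as All
open import Data.List.Relation.Unary.AllPairs using ([]; _∷_)
open import Data.List.Relation.Unary.Any using (here; there)
open import Data.List.Relation.Unary.Unique.Propositional using (Unique)
import Data.List.Relation.Unary.Unique.Propositional.Properties as Unique
open import Data.Nat.Base as ℕ using (ℕ; zero; suc; _<_)
open import Data.Nat.Coprimality using (Coprime; coprime⇒gcd≡1; gcd≡1⇒coprime)
import Data.Nat.Divisibility as ℕ
import Data.Nat.DivMod as ℕ
open import Data.Nat.Primality using (Prime; euclidsLemma; prime⇒irreducible; prime⇒nonZero)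
import Data.Nat.Properties as ℕ
import Data.Nat.Solver as ℕ
open import Data.Product.Base using (_×_; _,_; proj₁; proj₂; ∃-syntax)
open import Data.Rational.Base as ℚ using (ℚ; 0ℚ; 1ℚ)
open import Data.Rational.Literals using (fromℤ)
import Data.Rational.Properties as ℚ
import Data.Rational.Solver as ℚ
import Data.Rational.Unnormalised.Base as ℚᵘ
import Data.Rational.Unnormalised.Properties as ℚᵘ
open import Data.Sum.Base using ([_,_]′)
open import Function.Base using (_∘_; id)
open import Function.Bundles using (mk⇔)
open import Level using (0ℓ)
open import Relation.Binary.Definitions using (DecidableEquality)
open import Relation.Binary.PropositionalEquality
open import Relation.Nullary.Decidable using (yes; no; map′; _×-dec_)
open import Relation.Nullary.Negation.Core using (¬_; contradiction)

-- The rotation settles k = 1, 2, 3 but is silent about k = 4: comparing the sums of w ^ k and u ^ k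
-- leaves `T k` (the sum of the u ^ k) with the coefficient 1 - (-i)^k, that is 1 + i, 2, 1 - i and
-- 0. For k = 4 a second symmetry is needed, with a multiplier whose fourth power is not 1 modulo p;
-- 2 serves because 2^4 - 1 = 3 · 5. Since w = -y / (1 - p y), the coefficient of p^r y^(k+r) in w ^
-- k is (-1)^k binom(k+r-1, r), which is the origin of the constants 1, 2, 3. The precision fits
-- exactly: if `T (k+r)` is divisible by p^(5-k-r) for r ≥ 1, then every p^r `T (k+r)` is divisible
-- by p^(5-k), and so is the tail of the series after y^4. No infinite series occurs: w + y = p w y
-- makes each truncation an exact identity whose remainder is p^(5-k) times a polynomial in p, w and
-- y, hence lies in p^(5-k) R.

module _ {A : Set} {φ ψ : A → A} {xs : List A}
         (φ-∈ : ∀ {x} → x ∈ xs → φ x ∈ xs) (ψ-∈ : ∀ {x} → x ∈ xs → ψ x ∈ xs)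
         (φψ≡id : ∀ {x} → x ∈ xs → φ (ψ x) ≡ x) (ψφ≡id : ∀ {x} → x ∈ xs → ψ (φ x) ≡ x) where

  private
    -- The inverse law is tied to the fixed list `xs`, so the induction runs over a varying `ys`
    -- contained in it.
    map-unique : ∀ {ys} → (∀ {x} → x ∈ ys → x ∈ xs) → Unique ys → Unique (map φ ys)
    map-unique ys⊆xs []        = []
    map-unique {y ∷ _} ys⊆xs (y∉ ∷ ys!) =
      All.map⁺ (All.tabulate λ z∈ys φy≡φz → All.lookup y∉ z∈ys
        (trans (sym (ψφ≡id (ys⊆xs (here refl)))) (trans (cong ψ φy≡φz) (ψφ≡id (ys⊆xs (there z∈ys))))))
      ∷ map-unique (ys⊆xs ∘ there) ys!

  -- A list without repetitions is determined up to permutation by its members, so equality of the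
  -- two member sets is enough. The maps need to be inverse only on members: truncated subtraction
  -- and reduction modulo p are not invertible on all of ℕ.
  bijection⇒↭ : Unique xs → map φ xs ↭ xs
  bijection⇒↭ xs! = ∼bag⇒↭ (unique∧set⇒bag (map-unique id xs!) xs!
    (mk⇔ (λ z∈φxs → let x , x∈xs , z≡φx = ∈-map⁻ φ z∈φxs in subst (_∈ xs) (sym z≡φx) (φ-∈ x∈xs))
         (λ z∈xs → subst (_∈ map φ xs) (φψ≡id z∈xs) (∈-map⁺ φ (ψ-∈ z∈xs)))))

-- The congruence of a and b modulo p carries a multiple of p on each side, which keeps it in ℕ
-- without subtraction.
∣-resp-≡-mod : ∀ {p a b} c d → a ℕ.+ p ℕ.* c ≡ b ℕ.+ p ℕ.* d → p ℕ.∣ a → p ℕ.∣ b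
∣-resp-≡-mod {p} {a} {b} c d eq p∣a = ℕ.∣m+n∣m⇒∣n
  (subst (p ℕ.∣_) (trans eq (ℕ.+-comm b (p ℕ.* d))) (ℕ.∣m∣n⇒∣m+n p∣a (ℕ.m∣m*n c)))
  (ℕ.m∣m*n d)

-- Symmetries of the index set: rotation and scaling modulo p

module IndexSymmetries (p : ℕ) (pr : Prime p) where

  private instance _ = prime⇒nonZero pr

  -- Arithmetic form of membership in `indices p`: for a prime p, the gcd condition says that p does
  -- not divide the norm. The symmetries are checked on this form.
  Valid : ℕ × ℕ → Set
  Valid (n , m) = (0 < n × n < p) × (0 < m × m < p) × ¬ (p ℕ.∣ n ℕ.* n ℕ.+ m ℕ.* m)

  private
    Range = map suc (upTo (p ℕ.∸ 1))

    range⁻ : ∀ {n} → n ∈ Range → 0 < n × n < p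
    range⁻ n∈ with k , k∈ , refl ← ∈-map⁻ suc n∈ =
      ℕ.z<s , subst (suc k <_) (ℕ.suc-pred p) (ℕ.s<s (∈-upTo⁻ k∈))

    range⁺ : ∀ {n} → 0 < n → n < p → n ∈ Range
    range⁺ {suc n} _ n<p = ∈-map⁺ suc (∈-upTo⁺ (ℕ.s<s⁻¹ (subst (suc n <_) (sym (ℕ.suc-pred p)) n<p)))

    sum-of-squares : ∀ n m → m ℕ.^ 2 ℕ.+ n ℕ.^ 2 ≡ n ℕ.* n ℕ.+ m ℕ.* m
    sum-of-squares = solve 2 (λ n m → m :^ 2 :+ n :^ 2 := n :* n :+ m :* m) refl
      where open ℕ.+-*-Solver

  indices⁻ : ∀ {x} → x ∈ indices p → Valid x
  indices⁻ {n , m} x∈ with x∈xs , gcd≡1 ← ∈-filter⁻ _ {xs = cartesianProduct Range Range} x∈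
                      with n∈ , m∈ ← ∈-cartesianProduct⁻ Range Range x∈xs =
    -- Coprimality would force the common divisor p to be 1, which is not prime.
    range⁻ n∈ , range⁻ m∈ , λ p∣N → contradiction
      (subst Prime (gcd≡1⇒coprime gcd≡1 (ℕ.∣-refl , subst (p ℕ.∣_) (sym (sum-of-squares n m)) p∣N)) pr) λ ()

  indices⁺ : ∀ {x} → Valid x → x ∈ indices p
  indices⁺ {n , m} ((0<n , n<p) , (0<m , m<p) , p∤N) = ∈-filter⁺ _
    (∈-cartesianProduct⁺ (range⁺ 0<n n<p) (range⁺ 0<m m<p)) (coprime⇒gcd≡1 coprime)
    where
    coprime : Coprime p (m ℕ.^ 2 ℕ.+ n ℕ.^ 2)
    coprime (d∣p , d∣N) = [ id , (λ { refl → contradiction (subst (p ℕ.∣_) (sum-of-squares n m) d∣N) p∤N }) ]′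
      (prime⇒irreducible pr d∣p)

  indices! : Unique (indices p)
  indices! = Unique.filter⁺ _ (Unique.cartesianProduct⁺ range! range!)
    where
    range! : Unique Range
    range! = Unique.map⁺ ℕ.suc-injective (Unique.upTo⁺ (p ℕ.∸ 1))

  ρ ρ⁻¹ : ℕ × ℕ → ℕ × ℕ
  ρ   (n , m) = p ℕ.∸ m , n
  ρ⁻¹ (n , m) = m , p ℕ.∸ n

  private
    ∸-range : ∀ {n} → 0 < n → n < p → 0 < p ℕ.∸ n × p ℕ.∸ n < p
    ∸-range 0<n n<p = ℕ.m<n⇒0<n∸m n<p , ℕ.∸-monoʳ-< 0<n (ℕ.<⇒≤ n<p)

    -- Writing p = m′ + m with m′ = p ∸ m removes the truncated subtraction: m′² + p m = m² + p m′
    -- becomes a polynomial identity.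
    ∸-square : ∀ n m → m < p → p ℕ.∣ (p ℕ.∸ m) ℕ.* (p ℕ.∸ m) ℕ.+ n ℕ.* n → p ℕ.∣ n ℕ.* n ℕ.+ m ℕ.* m
    ∸-square n m m<p = ∣-resp-≡-mod m (p ℕ.∸ m)
      (subst (λ q → (p ℕ.∸ m) ℕ.* (p ℕ.∸ m) ℕ.+ n ℕ.* n ℕ.+ q ℕ.* m
                  ≡ n ℕ.* n ℕ.+ m ℕ.* m ℕ.+ q ℕ.* (p ℕ.∸ m))
        (ℕ.m∸n+n≡m (ℕ.<⇒≤ m<p))
        (solve 3 (λ n m m′ → m′ :* m′ :+ n :* n :+ (m′ :+ m) :* m := n :* n :+ m :* m :+ (m′ :+ m) :* m′)
          refl n m (p ℕ.∸ m)))
      where open ℕ.+-*-Solver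

  ρ-valid : ∀ {x} → Valid x → Valid (ρ x)
  ρ-valid {n , m} (n-range , (0<m , m<p) , p∤N) = ∸-range 0<m m<p , n-range , p∤N ∘ ∸-square n m m<p

  ρ⁻¹-valid : ∀ {x} → Valid x → Valid (ρ⁻¹ x)
  ρ⁻¹-valid {n , m} ((0<n , n<p) , m-range , p∤N) = m-range , ∸-range 0<n n<p ,
    p∤N ∘ subst (p ℕ.∣_) (ℕ.+-comm (m ℕ.* m) (n ℕ.* n)) ∘ ∸-square m n n<p
        ∘ subst (p ℕ.∣_) (ℕ.+-comm (m ℕ.* m) ((p ℕ.∸ n) ℕ.* (p ℕ.∸ n)))

  ρ-↭ : map ρ (indices p) ↭ indices p
  ρ-↭ = bijection⇒↭ {φ = ρ} {ψ = ρ⁻¹} (indices⁺ ∘ ρ-valid ∘ indices⁻) (indices⁺ ∘ ρ⁻¹-valid ∘ indices⁻)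
    (λ {x} x∈ → let (_ , n<p) , _ = indices⁻ x∈ in cong (_, proj₂ x) (ℕ.m∸[m∸n]≡n (ℕ.<⇒≤ n<p)))
    (λ {x} x∈ → let _ , (_ , m<p) , _ = indices⁻ x∈ in cong (proj₁ x ,_) (ℕ.m∸[m∸n]≡n (ℕ.<⇒≤ m<p)))
    indices!

  scale : ℕ → ℕ × ℕ → ℕ × ℕ
  scale g (n , m) = g ℕ.* n ℕ.% p , g ℕ.* m ℕ.% p

  private
    scale-range : ∀ {g n} → ¬ (p ℕ.∣ g) → 0 < n → n < p → 0 < g ℕ.* n ℕ.% p × g ℕ.* n ℕ.% p < p
    scale-range {g} {n} p∤g 0<n n<p =
      ℕ.n≢0⇒n>0 (λ gn%p≡0 → [ p∤g , ℕ.>⇒∤ {{ℕ.>-nonZero 0<n}} n<p ]′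
        (euclidsLemma g n pr (ℕ.m%n≡0⇒n∣m (g ℕ.* n) p gn%p≡0))) ,
      ℕ.m%n<n (g ℕ.* n) p

    scale-inverse : ∀ {g h n} → g ℕ.* h ℕ.% p ≡ 1 → n < p → g ℕ.* (h ℕ.* n ℕ.% p) ℕ.% p ≡ n
    scale-inverse {g} {h} {n} gh≡1 n<p = begin
      g ℕ.* (h ℕ.* n ℕ.% p) ℕ.% p                ≡⟨ ℕ.%-distribˡ-* g (h ℕ.* n ℕ.% p) p ⟩
      (g ℕ.% p) ℕ.* (h ℕ.* n ℕ.% p ℕ.% p) ℕ.% p  ≡⟨ cong (λ t → (g ℕ.% p) ℕ.* t ℕ.% p) (ℕ.m%n%n≡m%n (h ℕ.* n) p) ⟩
      (g ℕ.% p) ℕ.* (h ℕ.* n ℕ.% p) ℕ.% p        ≡⟨ ℕ.%-distribˡ-* g (h ℕ.* n) p ⟨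
      g ℕ.* (h ℕ.* n) ℕ.% p                      ≡⟨ cong (ℕ._% p) (ℕ.*-assoc g h n) ⟨
      g ℕ.* h ℕ.* n ℕ.% p                        ≡⟨ ℕ.%-distribˡ-* (g ℕ.* h) n p ⟩
      (g ℕ.* h ℕ.% p) ℕ.* (n ℕ.% p) ℕ.% p        ≡⟨ cong (λ t → t ℕ.* (n ℕ.% p) ℕ.% p) gh≡1 ⟩
      1 ℕ.* (n ℕ.% p) ℕ.% p                      ≡⟨ cong (ℕ._% p) (ℕ.*-identityˡ (n ℕ.% p)) ⟩
      n ℕ.% p ℕ.% p                              ≡⟨ ℕ.m%n%n≡m%n n p ⟩
      n ℕ.% p                                    ≡⟨ ℕ.m<n⇒m%n≡m n<p ⟩
      n                                          ∎
      where open ≡-Reasoning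

  -- The new norm is congruent to g² times the old one, so by Euclid's lemma p could divide it only
  -- by dividing g or the old norm.
  scale-valid : ∀ {g} → ¬ (p ℕ.∣ g) → ∀ {x} → Valid x → Valid (scale g x)
  scale-valid {g} p∤g {n , m} ((0<n , n<p) , (0<m , m<p) , p∤N) =
    scale-range p∤g 0<n n<p , scale-range p∤g 0<m m<p , λ p∣N′ →
    [ (λ p∣gg → [ p∤g , p∤g ]′ (euclidsLemma g g pr p∣gg)) , p∤N ]′
      (euclidsLemma (g ℕ.* g) (n ℕ.* n ℕ.+ m ℕ.* m) pr (∣-resp-≡-mod c 0 eq p∣N′))
    where
    a = g ℕ.* n ℕ.% p
    b = g ℕ.* m ℕ.% p
    q = g ℕ.* n ℕ./ p
    r = g ℕ.* m ℕ./ p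
    -- The cofactor of p in (a + q p)² + (b + r p)² - (a² + b²), where g n = a + q p and g m = b + r
    -- p.
    c = 2 ℕ.* a ℕ.* q ℕ.+ q ℕ.* q ℕ.* p ℕ.+ (2 ℕ.* b ℕ.* r ℕ.+ r ℕ.* r ℕ.* p)
    eq : a ℕ.* a ℕ.+ b ℕ.* b ℕ.+ p ℕ.* c ≡ g ℕ.* g ℕ.* (n ℕ.* n ℕ.+ m ℕ.* m) ℕ.+ p ℕ.* 0
    eq = begin
      a ℕ.* a ℕ.+ b ℕ.* b ℕ.+ p ℕ.* c
        ≡⟨ solve 5 (λ a b q r p → a :* a :+ b :* b
                                  :+ p :* (con 2 :* a :* q :+ q :* q :* p :+ (con 2 :* b :* r :+ r :* r :* p))
                 := (a :+ q :* p) :* (a :+ q :* p) :+ (b :+ r :* p) :* (b :+ r :* p)) refl a b q r p ⟩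
      (a ℕ.+ q ℕ.* p) ℕ.* (a ℕ.+ q ℕ.* p) ℕ.+ (b ℕ.+ r ℕ.* p) ℕ.* (b ℕ.+ r ℕ.* p)
        ≡⟨ cong₂ (λ s t → s ℕ.* s ℕ.+ t ℕ.* t) (ℕ.m≡m%n+[m/n]*n (g ℕ.* n) p) (ℕ.m≡m%n+[m/n]*n (g ℕ.* m) p) ⟨
      g ℕ.* n ℕ.* (g ℕ.* n) ℕ.+ g ℕ.* m ℕ.* (g ℕ.* m)
        ≡⟨ solve 4 (λ g n m p → g :* n :* (g :* n) :+ g :* m :* (g :* m)
                             := g :* g :* (n :* n :+ m :* m) :+ p :* con 0)
             refl g n m p ⟩
      g ℕ.* g ℕ.* (n ℕ.* n ℕ.+ m ℕ.* m) ℕ.+ p ℕ.* 0 ∎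
      where
      open ≡-Reasoning
      open ℕ.+-*-Solver

  -- An inverse h of g modulo p makes `scale h` inverse to `scale g` on residues, and its existence
  -- already shows that p divides neither g nor h.
  scale-↭ : ∀ {g h} → g ℕ.* h ℕ.% p ≡ 1 → map (scale g) (indices p) ↭ indices p
  scale-↭ {g} {h} gh≡1 = bijection⇒↭ {φ = scale g} {ψ = scale h}
    (indices⁺ ∘ scale-valid {g} (p∤ g h gh≡1) ∘ indices⁻) (indices⁺ ∘ scale-valid {h} (p∤ h g hg≡1) ∘ indices⁻)
    (λ {x} x∈ → let (_ , n<p) , (_ , m<p) , _ = indices⁻ x∈ in
      cong₂ _,_ (scale-inverse {g} {h} gh≡1 n<p) (scale-inverse {g} {h} gh≡1 m<p))
    (λ {x} x∈ → let (_ , n<p) , (_ , m<p) , _ = indices⁻ x∈ in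
      cong₂ _,_ (scale-inverse {h} {g} hg≡1 n<p) (scale-inverse {h} {g} hg≡1 m<p))
    indices!
    where
    hg≡1 : h ℕ.* g ℕ.% p ≡ 1
    hg≡1 = trans (cong (ℕ._% p) (ℕ.*-comm h g)) gh≡1
    p∤ : ∀ g h → g ℕ.* h ℕ.% p ≡ 1 → ¬ (p ℕ.∣ g)
    p∤ g h gh≡1 p∣g = 1≢0 (trans (sym gh≡1) (ℕ.n∣m⇒m%n≡0 (g ℕ.* h) p (ℕ.∣m⇒∣m*n h p∣g)))
      where
      1≢0 : 1 ≢ 0
      1≢0 ()

  -- A prime above 2 is odd, p = 1 + 2 k, and then 1 + k = (p + 1) / 2 is the inverse of 2.
  half : 2 < p → ∃[ h ] 2 ℕ.* h ℕ.% p ≡ 1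
  half 2<p with p ℕ.% 2 in p%2≡ | ℕ.m≡m%n+[m/n]*n p 2 | ℕ.m%n<n p 2
  ... | 0 | _  | _ = contradiction (prime⇒irreducible pr (ℕ.m%n≡0⇒n∣m p 2 p%2≡))
                       [ (λ ()) , (λ 2≡p → ℕ.<⇒≢ 2<p 2≡p) ]′
  ... | 1 | p≡ | _ = suc (p ℕ./ 2) , (begin
    2 ℕ.* suc (p ℕ./ 2) ℕ.% p            ≡⟨ cong (ℕ._% p) (2*[1+k] (p ℕ./ 2)) ⟩
    (1 ℕ.+ (1 ℕ.+ p ℕ./ 2 ℕ.* 2)) ℕ.% p  ≡⟨ cong (λ t → (1 ℕ.+ t) ℕ.% p) p≡ ⟨
    (1 ℕ.+ p) ℕ.% p                      ≡⟨ ℕ.[m+n]%n≡m%n 1 p ⟩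
    1 ℕ.% p                              ≡⟨ ℕ.m<n⇒m%n≡m (ℕ.<-trans (ℕ.s<s ℕ.z<s) 2<p) ⟩
    1                                    ∎)
    where
    open ≡-Reasoning
    open ℕ.+-*-Solver
    2*[1+k] : ∀ k → 2 ℕ.* suc k ≡ 1 ℕ.+ (1 ℕ.+ k ℕ.* 2)
    2*[1+k] = solve 1 (λ k → con 2 :* (con 1 :+ k) := con 1 :+ (con 1 :+ k :* con 2)) refl
  ... | suc (suc _) | _ | ℕ.s<s (ℕ.s<s ())

-- ℚ(i) as a commutative ring, and its inverses

neg : ℚ[i] → ℚ[i]
neg (a +i b) = (ℚ.- a) +i (ℚ.- b)

*-assoc : ∀ x y z → (x * y) * z ≡ x * (y * z)
*-assoc (a +i b) (c +i d) (e +i f) = cong₂ _+i_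
  (solve 6 (λ a b c d e f → (a :* c :- b :* d) :* e :- (a :* d :+ b :* c) :* f
                         := a :* (c :* e :- d :* f) :- b :* (c :* f :+ d :* e)) refl a b c d e f)
  (solve 6 (λ a b c d e f → (a :* c :- b :* d) :* f :+ (a :* d :+ b :* c) :* e
                         := a :* (c :* f :+ d :* e) :+ b :* (c :* e :- d :* f)) refl a b c d e f)
  where open ℚ.+-*-Solver

*-comm : ∀ x y → x * y ≡ y * x
*-comm (a +i b) (c +i d) = cong₂ _+i_
  (solve 4 (λ a b c d → a :* c :- b :* d := c :* a :- d :* b) refl a b c d)
  (solve 4 (λ a b c d → a :* d :+ b :* c := c :* b :+ d :* a) refl a b c d)
  where open ℚ.+-*-Solver

*-identityˡ : ∀ x → 1# * x ≡ x
*-identityˡ (a +i b) = cong₂ _+i_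
  (solve 2 (λ a b → con 1ℚ :* a :- con 0ℚ :* b := a) refl a b)
  (solve 2 (λ a b → con 1ℚ :* b :+ con 0ℚ :* a := b) refl a b)
  where open ℚ.+-*-Solver

*-distribˡ-+ : ∀ x y z → x * (y + z) ≡ x * y + x * z
*-distribˡ-+ (a +i b) (c +i d) (e +i f) = cong₂ _+i_
  (solve 6 (λ a b c d e f → a :* (c :+ e) :- b :* (d :+ f)
                         := (a :* c :- b :* d) :+ (a :* e :- b :* f)) refl a b c d e f)
  (solve 6 (λ a b c d e f → a :* (d :+ f) :+ b :* (c :+ e)
                         := (a :* d :+ b :* c) :+ (a :* f :+ b :* e)) refl a b c d e f)
  where open ℚ.+-*-Solver

+-*-isCommutativeRing : IsCommutativeRing _≡_ _+_ _*_ neg 0# 1#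
+-*-isCommutativeRing = record
  { isRing = record
    { +-isAbelianGroup = record
      { isGroup = record
        { isMonoid = record
          { isSemigroup = record
            { isMagma = record { isEquivalence = isEquivalence ; ∙-cong = cong₂ _+_ }
            ; assoc = λ (a +i b) (c +i d) (e +i f) → cong₂ _+i_ (ℚ.+-assoc a c e) (ℚ.+-assoc b d f)
            }
          ; identity = (λ (a +i b) → cong₂ _+i_ (ℚ.+-identityˡ a) (ℚ.+-identityˡ b))
                     , (λ (a +i b) → cong₂ _+i_ (ℚ.+-identityʳ a) (ℚ.+-identityʳ b))
          }
        ; inverse = (λ (a +i b) → cong₂ _+i_ (ℚ.+-inverseˡ a) (ℚ.+-inverseˡ b))
                  , (λ (a +i b) → cong₂ _+i_ (ℚ.+-inverseʳ a) (ℚ.+-inverseʳ b))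
        ; ⁻¹-cong = cong neg
        }
      ; comm = λ (a +i b) (c +i d) → cong₂ _+i_ (ℚ.+-comm a c) (ℚ.+-comm b d)
      }
    ; *-cong = cong₂ _*_
    ; *-assoc = *-assoc
    ; *-identity = *-identityˡ , λ x → trans (*-comm x 1#) (*-identityˡ x)
    ; distrib = *-distribˡ-+ , λ x y z → trans (*-comm (y + z) x)
                  (trans (*-distribˡ-+ x y z) (cong₂ _+_ (*-comm x y) (*-comm x z)))
    }
  ; *-comm = *-comm
  }

+-*-commutativeRing : CommutativeRing 0ℓ 0ℓ
+-*-commutativeRing = record { isCommutativeRing = +-*-isCommutativeRing }

open CommutativeRing +-*-commutativeRing using (+-isCommutativeMonoid; +-identityˡ; *-identityʳ; zeroʳ)

-- The comparison is made on unnormalised fractions, where addition involves no reduction by a gcd.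
fromℤ-+ : ∀ a b → fromℤ (a ℤ.+ b) ≡ fromℤ a ℚ.+ fromℤ b
fromℤ-+ a b = ℚ.toℚᵘ-injective (ℚᵘ.≃-trans
  (ℚᵘ.*≡* (solve 2 (λ a b → (a :+ b) :* con ℤ.1ℤ := (a :* con ℤ.1ℤ :+ b :* con ℤ.1ℤ) :* con ℤ.1ℤ) refl a b))
  (ℚᵘ.≃-sym (ℚ.toℚᵘ-homo-+ (fromℤ a) (fromℤ b))))
  where open ℤ.+-*-Solver

fromℤ-* : ∀ a b → fromℤ (a ℤ.* b) ≡ fromℤ a ℚ.* fromℤ b
fromℤ-* a b = ℚ.toℚᵘ-injective (ℚᵘ.≃-sym (ℚ.toℚᵘ-homo-* (fromℤ a) (fromℤ b)))

fromℤ-neg : ∀ a → fromℤ (ℤ.- a) ≡ ℚ.- fromℤ a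
fromℤ-neg (+ 0)        = refl
fromℤ-neg ℤ.+[1+ n ]   = refl
fromℤ-neg ℤ.-[1+ n ]   = refl

⁻¹-inverse : ∀ z → ¬ (norm z ≡ 0ℚ) → z * z ⁻¹ ≡ 1#
⁻¹-inverse z@(a +i b) N≢0 with norm z ℚ.≟ 0ℚ
... | yes N≡0 = contradiction N≡0 N≢0
... | no  N≢0′ = cong₂ _+i_
  (trans (solve 3 (λ a b r → a :* (a :* r) :- b :* ((:- b) :* r) := (a :* a :+ b :* b) :* r) refl a b (ℚ.1/ norm z))
         (ℚ.*-inverseʳ (norm z)))
  (solve 3 (λ a b r → a :* ((:- b) :* r) :+ b :* (a :* r) := con 0ℚ) refl a b (ℚ.1/ norm z))
  where
  open ℚ.+-*-Solver
  instance _ = ℚ.≢-nonZero N≢0′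

_≟_ : DecidableEquality ℚ[i]
(a +i b) ≟ (c +i d) = map′ (λ { (refl , refl) → refl }) (λ { refl → refl , refl })
                           (a ℚ.≟ c ×-dec b ℚ.≟ d)

-- The coefficients are the elements of ℚ(i) themselves, with decidable equality, so the solver
-- computes with constants such as `i` and can use i² = -1.
module +-*-Solver = Solver (ACR.fromCommutativeRing +-*-commutativeRing) _≟_

norm-* : ∀ x y → norm (x * y) ≡ norm x ℚ.* norm y
norm-* (a +i b) (c +i d) =
  solve 4 (λ a b c d → (a :* c :- b :* d) :* (a :* c :- b :* d) :+ (a :* d :+ b :* c) :* (a :* d :+ b :* c)
                    := (a :* a :+ b :* b) :* (c :* c :+ d :* d)) refl a b c d
  where open ℚ.+-*-Solver

invertible⇒norm≢0 : ∀ {z w} → z * w ≡ 1# → ¬ (norm z ≡ 0ℚ)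
invertible⇒norm≢0 {z} {w} zw≡1 N≡0 = contradiction 1≡0 λ ()
  where
  1≡0 : 1ℚ ≡ 0ℚ
  1≡0 = begin
    norm 1#            ≡⟨ cong norm zw≡1 ⟨
    norm (z * w)       ≡⟨ norm-* z w ⟩
    norm z ℚ.* norm w  ≡⟨ cong (ℚ._* norm w) N≡0 ⟩
    0ℚ ℚ.* norm w      ≡⟨ ℚ.*-zeroˡ (norm w) ⟩
    0ℚ                 ∎
    where open ≡-Reasoning

-- Serves to identify the inverse of a power with the power of the inverse. The nonzero norm that
-- unlocks the total `_⁻¹` comes from w itself, by multiplicativity of the norm.
⁻¹-unique : ∀ {z w} → z * w ≡ 1# → z ⁻¹ ≡ w
⁻¹-unique {z} {w} zw≡1 = begin
  z ⁻¹            ≡⟨ *-identityʳ (z ⁻¹) ⟨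
  z ⁻¹ * 1#       ≡⟨ cong (z ⁻¹ *_) zw≡1 ⟨
  z ⁻¹ * (z * w)  ≡⟨ *-assoc (z ⁻¹) z w ⟨
  z ⁻¹ * z * w    ≡⟨ cong (_* w) (trans (*-comm (z ⁻¹) z) (⁻¹-inverse z (invertible⇒norm≢0 {z} {w} zw≡1))) ⟩
  1# * w          ≡⟨ *-identityˡ w ⟩
  w               ∎
  where open ≡-Reasoning

^-inverse : ∀ {z w} k → z * w ≡ 1# → z ^ k * w ^ k ≡ 1#
^-inverse         zero    zw≡1 = refl
^-inverse {z} {w} (suc k) zw≡1 = begin
  z * z ^ k * (w * w ^ k)    ≡⟨ solve 4 (λ z s w t → z :* s :* (w :* t) := z :* w :* (s :* t)) refl z (z ^ k) w (w ^ k) ⟩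
  z * w * (z ^ k * w ^ k)    ≡⟨ cong₂ _*_ zw≡1 (^-inverse k zw≡1) ⟩
  1#                         ∎
  where
  open ≡-Reasoning
  open +-*-Solver

-- The solver's own _:^_ does not evaluate to the powers z ^ k used here.
module _ {n : ℕ} where
  open +-*-Solver

  infixr 9 _:^′_
  _:^′_ : Polynomial n → ℕ → Polynomial n
  x :^′ zero  = con 1#
  x :^′ suc k = x :* x :^′ k

-- Turns an equation that holds only under the relation x = y into an unconditional ring identity,
-- which the solver can check once the cofactor `c` of x - y is supplied.
≡-modulo : ∀ {x y} a b c → x ≡ y → a ≡ b + c * (x - y) → a ≡ b
≡-modulo {x} a b c refl a≡ = begin
  a                 ≡⟨ a≡ ⟩
  b + c * (x - x)   ≡⟨ solve 3 (λ x b c → b :+ c :* (x :- x) := b) refl x b c ⟩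
  b                 ∎
  where
  open ≡-Reasoning
  open +-*-Solver

-- Polynomial relations between the reciprocals

2# 3# 16# i : ℚ[i]
2#  = ι (+ 2)
3#  = ι (+ 3)
16# = ι (+ 16)
i   = 0ℚ +i 1ℚ

-- In the next four lemmas the third explicit argument of ≡-modulo is the quotient of the
-- difference of the two sides by the relation, obtained by polynomial division.
reflected-reciprocal¹ : ∀ π y w → w + y ≡ π * w * y →
  w ^ 1 + 1# * π ^ 0 * y ^ 1 + 1# * π ^ 1 * y ^ 2 + 1# * π ^ 2 * y ^ 3 + 1# * π ^ 3 * y ^ 4 - 0#
  ≡ π ^ 4 * (y ^ 4 * w)
reflected-reciprocal¹ π y w h = ≡-modulo _ _ (1# + π * y + π ^ 2 * y ^ 2 + π ^ 3 * y ^ 3) h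
  (solve 3 (λ π y w →
     w :^′ 1 :+ con 1# :* π :^′ 0 :* y :^′ 1 :+ con 1# :* π :^′ 1 :* y :^′ 2
       :+ con 1# :* π :^′ 2 :* y :^′ 3 :+ con 1# :* π :^′ 3 :* y :^′ 4 :- con 0#
     := π :^′ 4 :* (y :^′ 4 :* w)
        :+ (con 1# :+ π :* y :+ π :^′ 2 :* y :^′ 2 :+ π :^′ 3 :* y :^′ 3) :* (w :+ y :- π :* w :* y))
   refl π y w)
  where open +-*-Solver

reflected-reciprocal² : ∀ π y w → w + y ≡ π * w * y →
  w ^ 2 + neg 1# * π ^ 0 * y ^ 2 + neg 2# * π ^ 1 * y ^ 3 + neg 3# * π ^ 2 * y ^ 4 - 0#
  ≡ π ^ 3 * (w ^ 2 * y ^ 3 - 3# * w * y ^ 4)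
reflected-reciprocal² π y w h = ≡-modulo _ _
  ((1# + π * y + π ^ 2 * y ^ 2) * w - (y + 2# * π * y ^ 2 + 3# * π ^ 2 * y ^ 3)) h
  (solve 3 (λ π y w →
     w :^′ 2 :+ con (neg 1#) :* π :^′ 0 :* y :^′ 2 :+ con (neg 2#) :* π :^′ 1 :* y :^′ 3
       :+ con (neg 3#) :* π :^′ 2 :* y :^′ 4 :- con 0#
     := π :^′ 3 :* (w :^′ 2 :* y :^′ 3 :- con 3# :* w :* y :^′ 4)
        :+ ((con 1# :+ π :* y :+ π :^′ 2 :* y :^′ 2) :* w
            :- (y :+ con 2# :* π :* y :^′ 2 :+ con 3# :* π :^′ 2 :* y :^′ 3)) :* (w :+ y :- π :* w :* y))
   refl π y w)
  where open +-*-Solver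

reflected-reciprocal³ : ∀ π y w → w + y ≡ π * w * y →
  w ^ 3 + 1# * π ^ 0 * y ^ 3 + 3# * π ^ 1 * y ^ 4 - 0#
  ≡ π ^ 2 * (π * y ^ 3 * w ^ 3 + 3# * y ^ 4 * w - 3# * y ^ 3 * w ^ 2)
reflected-reciprocal³ π y w h = ≡-modulo _ _
  ((w + y) ^ 2 + π * w * y * (w + y) + (π * w * y) ^ 2 - 3# * w * y - 3# * π * y ^ 2 * (w - y)) h
  (solve 3 (λ π y w →
     w :^′ 3 :+ con 1# :* π :^′ 0 :* y :^′ 3 :+ con 3# :* π :^′ 1 :* y :^′ 4 :- con 0#
     := π :^′ 2 :* (π :* y :^′ 3 :* w :^′ 3 :+ con 3# :* y :^′ 4 :* w :- con 3# :* y :^′ 3 :* w :^′ 2)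
        :+ ((w :+ y) :^′ 2 :+ π :* w :* y :* (w :+ y) :+ (π :* w :* y) :^′ 2 :- con 3# :* w :* y
            :- con 3# :* π :* y :^′ 2 :* (w :- y)) :* (w :+ y :- π :* w :* y))
   refl π y w)
  where open +-*-Solver

doubled-reciprocal⁴ : ∀ π t u v → 2# * v ≡ u + π * t * u * v →
  16# * v ^ 4 - u ^ 4 ≡ π ^ 1 * (((2# * v) ^ 2 + u ^ 2) * (2# * v + u) * t * u * v)
doubled-reciprocal⁴ π t u v h = ≡-modulo _ _ (((2# * v) ^ 2 + u ^ 2) * (2# * v + u)) h
  (solve 4 (λ π t u v →
     con 16# :* v :^′ 4 :- u :^′ 4
     := π :^′ 1 :* (((con 2# :* v) :^′ 2 :+ u :^′ 2) :* (con 2# :* v :+ u) :* t :* u :* v)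
        :+ ((con 2# :* v) :^′ 2 :+ u :^′ 2) :* (con 2# :* v :+ u)
           :* (con 2# :* v :- (u :+ π :* t :* u :* v)))
   refl π t u v)
  where open +-*-Solver

-- Since 1/w = π + i z and 1/(i u) = -i z, the two reciprocals add up to π; multiplying by w · i u
-- clears the denominators.
reflect-relation : ∀ π z u w → z * u ≡ 1# → (π + i * z) * w ≡ 1# → w + i * u ≡ π * w * (i * u)
reflect-relation π z u w zu≡1 z′w≡1 =
  ≡-modulo _ _ (neg w) zu≡1 (≡-modulo _ _ (neg (i * u)) z′w≡1
  (solve 4 (λ π z u w →
     w :+ con i :* u := π :* w :* (con i :* u) :+ (:- w) :* (z :* u :- con 1#)
       :+ (:- (con i :* u)) :* ((π :+ con i :* z) :* w :- con 1#)) refl π z u w))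
  where open +-*-Solver

-- This is z′ + π t = 2 z multiplied by u v, with z u and z′ v replaced by 1.
double-relation : ∀ π t z z′ u v → z′ + π * t ≡ 2# * z → z * u ≡ 1# → z′ * v ≡ 1# →
  2# * v ≡ u + π * t * u * v
double-relation π t z z′ u v z′≡ zu≡1 z′v≡1 =
  ≡-modulo _ _ (neg (u * v)) z′≡ (≡-modulo _ _ (neg (2# * v)) zu≡1 (≡-modulo _ _ u z′v≡1
  (solve 6 (λ π t z z′ u v →
     con 2# :* v := u :+ π :* t :* u :* v :+ (:- (u :* v)) :* (z′ :+ π :* t :- con 2# :* z)
       :+ (:- (con 2# :* v)) :* (z :* u :- con 1#) :+ u :* (z′ :* v :- con 1#)) refl π t z z′ u v)))
  where open +-*-Solver

-- Powers, and Gaussian integers inside ℚ(i)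

^-+ : ∀ (x : ℚ[i]) l j → x ^ (l ℕ.+ j) ≡ x ^ l * x ^ j
^-+ x zero    j = sym (*-identityˡ (x ^ j))
^-+ x (suc l) j = trans (cong (x *_) (^-+ x l j)) (sym (*-assoc x (x ^ l) (x ^ j)))

*-^ : ∀ x y k → (x * y) ^ k ≡ x ^ k * y ^ k
*-^ x y zero    = refl
*-^ x y (suc k) = trans (cong (x * y *_) (*-^ x y k))
  (solve 4 (λ x y a b → x :* y :* (a :* b) := x :* a :* (y :* b)) refl x y (x ^ k) (y ^ k))
  where open +-*-Solver

fromℤ-injective : ∀ {a b} → fromℤ a ≡ fromℤ b → a ≡ b
fromℤ-injective = cong ℚ.numerator

infixl 7 _*ᶻ_
infixl 6 _+ᶻ_

_+ᶻ_ _*ᶻ_ : ℤ[i] → ℤ[i] → ℤ[i]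
(a +i b) +ᶻ (c +i d) = (a ℤ.+ c) +i (b ℤ.+ d)
(a +i b) *ᶻ (c +i d) = (a ℤ.* c ℤ.- b ℤ.* d) +i (a ℤ.* d ℤ.+ b ℤ.* c)

fromℤ[i]-+ : ∀ x y → fromℤ[i] (x +ᶻ y) ≡ fromℤ[i] x + fromℤ[i] y
fromℤ[i]-+ (a +i b) (c +i d) = cong₂ _+i_ (fromℤ-+ a c) (fromℤ-+ b d)

fromℤ[i]-* : ∀ x y → fromℤ[i] (x *ᶻ y) ≡ fromℤ[i] x * fromℤ[i] y
fromℤ[i]-* (a +i b) (c +i d) = cong₂ _+i_
  (trans (fromℤ-+ (a ℤ.* c) (ℤ.- (b ℤ.* d)))
         (cong₂ ℚ._+_ (fromℤ-* a c) (trans (fromℤ-neg (b ℤ.* d)) (cong ℚ.-_ (fromℤ-* b d)))))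
  (trans (fromℤ-+ (a ℤ.* d) (b ℤ.* c)) (cong₂ ℚ._+_ (fromℤ-* a d) (fromℤ-* b c)))

ι-* : ∀ a b → ι (a ℤ.* b) ≡ ι a * ι b
ι-* a b = trans (cong fromℤ[i] (cong₂ _+i_ (re≡ a b) (im≡ a b)))
                (fromℤ[i]-* (a +i (+ 0)) (b +i (+ 0)))
  where
  open ℤ.+-*-Solver
  re≡ : ∀ a b → a ℤ.* b ≡ a ℤ.* b ℤ.- + 0 ℤ.* + 0
  re≡ = solve 2 (λ a b → a :* b := a :* b :- con (+ 0) :* con (+ 0)) refl
  im≡ : ∀ a b → + 0 ≡ a ℤ.* + 0 ℤ.+ + 0 ℤ.* b
  im≡ = solve 2 (λ a b → con (+ 0) := a :* con (+ 0) :+ con (+ 0) :* b) refl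

norm-fromℤ[i] : ∀ a b → norm (fromℤ[i] (a +i b)) ≡ fromℤ (a ℤ.* a ℤ.+ b ℤ.* b)
norm-fromℤ[i] a b = sym (trans (fromℤ-+ (a ℤ.* a) (b ℤ.* b)) (cong₂ ℚ._+_ (fromℤ-* a a) (fromℤ-* b b)))

fromℤ[i]-norm : ∀ a b → fromℤ[i] (a +i b) * fromℤ[i] (a +i (ℤ.- b)) ≡ ι (a ℤ.* a ℤ.+ b ℤ.* b)
fromℤ[i]-norm a b = trans (sym (fromℤ[i]-* (a +i b) (a +i (ℤ.- b))))
  (cong fromℤ[i] (cong₂ _+i_
    (solve 2 (λ a b → a :* a :- b :* (:- b) := a :* a :+ b :* b) refl a b)
    (solve 2 (λ a b → a :* (:- b) :+ b :* a := con (+ 0)) refl a b)))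
  where open ℤ.+-*-Solver

ι-inverse : ∀ b → b ≢ + 0 → ι b * ι b ⁻¹ ≡ 1#
ι-inverse b b≢0 = ⁻¹-inverse (ι b) λ N≡0 →
  [ b≢0 , b≢0 ]′ (ℤ.i*j≡0⇒i≡0∨j≡0 b
    (trans (sym (ℤ.+-identityʳ (b ℤ.* b)))
           (fromℤ-injective (trans (sym (norm-fromℤ[i] b (+ 0))) N≡0))))

-- Finite sums

∑-+ : ∀ {A : Set} (f g : A → ℚ[i]) xs → ∑ (map (λ x → f x + g x) xs) ≡ ∑ (map f xs) + ∑ (map g xs)
∑-+ f g []       = refl
∑-+ f g (x ∷ xs) = begin
  f x + g x + ∑ (map (λ x → f x + g x) xs)         ≡⟨ cong (λ s → f x + g x + s) (∑-+ f g xs) ⟩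
  f x + g x + (∑ (map f xs) + ∑ (map g xs))        ≡⟨ solve 4 (λ a b c d → a :+ b :+ (c :+ d) := a :+ c :+ (b :+ d))
                                                        refl (f x) (g x) (∑ (map f xs)) (∑ (map g xs)) ⟩
  f x + ∑ (map f xs) + (g x + ∑ (map g xs))        ∎
  where
  open ≡-Reasoning
  open +-*-Solver

∑-* : ∀ {A : Set} c (f : A → ℚ[i]) xs → ∑ (map (λ x → c * f x) xs) ≡ c * ∑ (map f xs)
∑-* c f []       = sym (zeroʳ c)
∑-* c f (x ∷ xs) = trans (cong (λ s → c * f x + s) (∑-* c f xs)) (sym (*-distribˡ-+ c (f x) (∑ (map f xs))))

∑-↭ : ∀ {xs ys} → xs ↭ ys → ∑ xs ≡ ∑ ys
∑-↭ xs↭ys = foldr-commMonoid (setoid ℚ[i]) +-isCommutativeMonoid (↭⇒↭ₛ xs↭ys)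

∑-reindex : ∀ {A : Set} {φ : A → A} {xs} (f : A → ℚ[i]) → map φ xs ↭ xs →
            ∑ (map (λ x → f (φ x)) xs) ≡ ∑ (map f xs)
∑-reindex {xs = xs} f φxs↭xs = trans (cong ∑ (map-∘ xs)) (∑-↭ (map⁺ f φxs↭xs))

∑-cong : ∀ {A : Set} (f g : A → ℚ[i]) xs → (∀ {x} → x ∈ xs → f x ≡ g x) → ∑ (map f xs) ≡ ∑ (map g xs)
∑-cong f g []       f≡g = refl
∑-cong f g (x ∷ xs) f≡g = cong₂ _+_ (f≡g (here refl)) (∑-cong f g xs (f≡g ∘ there))

∑-0 : ∀ {A : Set} (xs : List A) → ∑ (map (λ _ → 0#) xs) ≡ 0#
∑-0 []       = refl
∑-0 (x ∷ xs) = trans (+-identityˡ _) (∑-0 xs)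

-- The ring R and congruences in it

module Localization (p : ℕ) (pr : Prime p) where

  ∤-* : ∀ b c → ¬ (+ p ∣ b) → ¬ (+ p ∣ c) → ¬ (+ p ∣ b ℤ.* c)
  ∤-* b c p∤b p∤c p∣bc =
    [ p∤b , p∤c ]′ (euclidsLemma ℤ.∣ b ∣ ℤ.∣ c ∣ pr (subst (p ℕ.∣_) (ℤ.abs-* b c) p∣bc))

  ∤⇒≢0 : ∀ {b} → ¬ (+ p ∣ b) → b ≢ + 0
  ∤⇒≢0 p∤b refl = p∤b (p ℕ.∣0)

  ∤1 : ¬ (+ p ∣ + 1)
  ∤1 p∣1 with refl ← ℕ.∣1⇒≡1 p∣1 = contradiction pr λ ()

  -- Together with `R-elim` this gives membership with cleared denominators, so that the closure
  -- proofs for sums and products avoid `_⁻¹`.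
  R-intro : ∀ a b {z} → ¬ (+ p ∣ b) → ι b * z ≡ fromℤ[i] a → R p z
  R-intro a b {z} p∤b bz≡a = a , b , p∤b , (begin
    z                        ≡⟨ ≡-modulo _ _ (neg z) (ι-inverse b (∤⇒≢0 p∤b))
                                  (solve 3 (λ z b c → z := b :* z :* c :+ (:- z) :* (b :* c :- con 1#))
                                    refl z (ι b) (ι b ⁻¹)) ⟩
    ι b * z * ι b ⁻¹         ≡⟨ cong (_* ι b ⁻¹) bz≡a ⟩
    fromℤ[i] a * ι b ⁻¹      ∎)
    where
    open ≡-Reasoning
    open +-*-Solver

  R-elim : ∀ {z} → R p z → ∃[ a ] ∃[ b ] (¬ (+ p ∣ b)) × ι b * z ≡ fromℤ[i] a
  R-elim (a , b , p∤b , refl) = a , b , p∤b ,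
    ≡-modulo _ _ (fromℤ[i] a) (ι-inverse b (∤⇒≢0 p∤b))
      (solve 3 (λ a b c → b :* (a :* c) := a :+ a :* (b :* c :- con 1#)) refl (fromℤ[i] a) (ι b) (ι b ⁻¹))
    where open +-*-Solver

  R-ℤ[i] : ∀ a → R p (fromℤ[i] a)
  R-ℤ[i] a = R-intro a (+ 1) ∤1 (*-identityˡ (fromℤ[i] a))

  R-* : ∀ {x y} → R p x → R p y → R p (x * y)
  R-* {x} {y} x∈R y∈R with a , b , p∤b , bx≡a ← R-elim x∈R | c , d , p∤d , dy≡c ← R-elim y∈R =
    R-intro (a *ᶻ c) (b ℤ.* d) (∤-* b d p∤b p∤d) (begin
      ι (b ℤ.* d) * (x * y)      ≡⟨ cong (_* (x * y)) (ι-* b d) ⟩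
      ι b * ι d * (x * y)        ≡⟨ solve 4 (λ b d x y → b :* d :* (x :* y) := (b :* x) :* (d :* y))
                                      refl (ι b) (ι d) x y ⟩
      (ι b * x) * (ι d * y)      ≡⟨ cong₂ _*_ bx≡a dy≡c ⟩
      fromℤ[i] a * fromℤ[i] c    ≡⟨ fromℤ[i]-* a c ⟨
      fromℤ[i] (a *ᶻ c)          ∎)
    where
    open ≡-Reasoning
    open +-*-Solver

  R-+ : ∀ {x y} → R p x → R p y → R p (x + y)
  R-+ {x} {y} x∈R y∈R with a , b , p∤b , bx≡a ← R-elim x∈R | c , d , p∤d , dy≡c ← R-elim y∈R =
    R-intro ((d +i (+ 0)) *ᶻ a +ᶻ (b +i (+ 0)) *ᶻ c) (b ℤ.* d) (∤-* b d p∤b p∤d) (begin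
      ι (b ℤ.* d) * (x + y)               ≡⟨ cong (_* (x + y)) (ι-* b d) ⟩
      ι b * ι d * (x + y)                 ≡⟨ solve 4 (λ b d x y → b :* d :* (x :+ y) := d :* (b :* x) :+ b :* (d :* y))
                                               refl (ι b) (ι d) x y ⟩
      ι d * (ι b * x) + ι b * (ι d * y)   ≡⟨ cong₂ (λ s t → ι d * s + ι b * t) bx≡a dy≡c ⟩
      ι d * fromℤ[i] a + ι b * fromℤ[i] c
        ≡⟨ cong₂ _+_ (fromℤ[i]-* (d +i (+ 0)) a) (fromℤ[i]-* (b +i (+ 0)) c) ⟨
      fromℤ[i] ((d +i (+ 0)) *ᶻ a) + fromℤ[i] ((b +i (+ 0)) *ᶻ c)
        ≡⟨ fromℤ[i]-+ ((d +i (+ 0)) *ᶻ a) ((b +i (+ 0)) *ᶻ c) ⟨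
      fromℤ[i] ((d +i (+ 0)) *ᶻ a +ᶻ (b +i (+ 0)) *ᶻ c) ∎)
    where
    open ≡-Reasoning
    open +-*-Solver

  R-neg : ∀ {x} → R p x → R p (neg x)
  R-neg {x} x∈R = subst (R p) (solve 1 (λ x → con (neg 1#) :* x := :- x) refl x)
    (R-* (R-ℤ[i] ((ℤ.- (+ 1)) +i (+ 0))) x∈R)
    where open +-*-Solver

  R-^ : ∀ {x} k → R p x → R p (x ^ k)
  R-^ zero    x∈R = R-ℤ[i] ((+ 1) +i (+ 0))
  R-^ (suc k) x∈R = R-* x∈R (R-^ k x∈R)

  R-÷ι : ∀ {b x} → ¬ (+ p ∣ b) → R p x → R p (ι b ⁻¹ * x)
  R-÷ι {b} {x} p∤b x∈R with a , c , p∤c , cx≡a ← R-elim x∈R =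
    R-intro a (b ℤ.* c) (∤-* b c p∤b p∤c) (begin
      ι (b ℤ.* c) * (ι b ⁻¹ * x)       ≡⟨ cong (_* (ι b ⁻¹ * x)) (ι-* b c) ⟩
      ι b * ι c * (ι b ⁻¹ * x)         ≡⟨ ≡-modulo _ _ (ι c * x) (ι-inverse b (∤⇒≢0 p∤b))
                                            (solve 4 (λ b c d x → b :* c :* (d :* x) :=
                                                c :* x :+ c :* x :* (b :* d :- con 1#))
                                              refl (ι b) (ι c) (ι b ⁻¹) x) ⟩
      ι c * x                           ≡⟨ cx≡a ⟩
      fromℤ[i] a                        ∎)
    where
    open ≡-Reasoning
    open +-*-Solver

  -- Rationalising the denominator: z u = 1 gives N(z) u = z̄, and p does not divide N(z).
  R-unit-⁻¹ : ∀ a b {u} → ¬ (+ p ∣ a ℤ.* a ℤ.+ b ℤ.* b) → fromℤ[i] (a +i b) * u ≡ 1# → R p u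
  R-unit-⁻¹ a b {u} p∤N zu≡1 = R-intro (a +i (ℤ.- b)) (a ℤ.* a ℤ.+ b ℤ.* b) p∤N (begin
    ι (a ℤ.* a ℤ.+ b ℤ.* b) * u     ≡⟨ cong (_* u) (fromℤ[i]-norm a b) ⟨
    z * z̄ * u                        ≡⟨ solve 3 (λ z z̄ u → z :* z̄ :* u := z̄ :* (z :* u)) refl z z̄ u ⟩
    z̄ * (z * u)                      ≡⟨ cong (z̄ *_) zu≡1 ⟩
    z̄ * 1#                           ≡⟨ *-identityʳ z̄ ⟩
    z̄                                ∎)
    where
    z = fromℤ[i] (a +i b)
    z̄ = fromℤ[i] (a +i (ℤ.- b))
    open ≡-Reasoning
    open +-*-Solver

  unit-⁻¹ : ∀ a b → ¬ (+ p ∣ a ℤ.* a ℤ.+ b ℤ.* b) → fromℤ[i] (a +i b) * fromℤ[i] (a +i b) ⁻¹ ≡ 1#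
  unit-⁻¹ a b p∤N = ⁻¹-inverse (fromℤ[i] (a +i b)) λ N≡0 →
    ∤⇒≢0 p∤N (fromℤ-injective (trans (sym (norm-fromℤ[i] a b)) N≡0))

  ≅-refl : ∀ j {x} → x ≅ x [mod p ^ j ]
  ≅-refl j {x} = 0# , R-ℤ[i] ((+ 0) +i (+ 0)) ,
    solve 2 (λ x π → x :- x := π :* con 0#) refl x (ι (+ p) ^ j)
    where open +-*-Solver

  ≅-+ : ∀ j {x y z w} → x ≅ y [mod p ^ j ] → z ≅ w [mod p ^ j ] → (x + z) ≅ (y + w) [mod p ^ j ]
  ≅-+ j {x} {y} {z} {w} (r , r∈R , x-y) (s , s∈R , z-w) = r + s , R-+ r∈R s∈R , (begin
    x + z - (y + w)                          ≡⟨ solve 4 (λ x y z w → x :+ z :- (y :+ w) := (x :- y) :+ (z :- w))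
                                                  refl x y z w ⟩
    (x - y) + (z - w)                        ≡⟨ cong₂ _+_ x-y z-w ⟩
    ι (+ p) ^ j * r + ι (+ p) ^ j * s        ≡⟨ *-distribˡ-+ (ι (+ p) ^ j) r s ⟨
    ι (+ p) ^ j * (r + s)                    ∎)
    where
    open ≡-Reasoning
    open +-*-Solver

  ≅-* : ∀ j {x y c} → R p c → x ≅ y [mod p ^ j ] → (c * x) ≅ (c * y) [mod p ^ j ]
  ≅-* j {x} {y} {c} c∈R (r , r∈R , x-y) = c * r , R-* c∈R r∈R , (begin
    c * x - c * y           ≡⟨ solve 3 (λ c x y → c :* x :- c :* y := c :* (x :- y)) refl c x y ⟩
    c * (x - y)             ≡⟨ cong (c *_) x-y ⟩
    c * (ι (+ p) ^ j * r)   ≡⟨ solve 3 (λ c π r → c :* (π :* r) := π :* (c :* r)) refl c (ι (+ p) ^ j) r ⟩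
    ι (+ p) ^ j * (c * r)   ∎)
    where
    open ≡-Reasoning
    open +-*-Solver

  -- An integer prime to p is a unit of R, so the old quotient divided by b is again in R.
  ≅0-cancel : ∀ j {b x} → ¬ (+ p ∣ b) → (ι b * x) ≅ 0# [mod p ^ j ] → x ≅ 0# [mod p ^ j ]
  ≅0-cancel j {b} {x} p∤b (r , r∈R , bx) = ι b ⁻¹ * r , R-÷ι {b} {r} p∤b r∈R , (begin
    x - 0#                          ≡⟨ ≡-modulo _ _ (neg x) (ι-inverse b (∤⇒≢0 p∤b))
                                         (solve 3 (λ b c x → x :- con 0# := c :* (b :* x :- con 0#)
                                             :+ (:- x) :* (b :* c :- con 1#)) refl (ι b) (ι b ⁻¹) x) ⟩
    ι b ⁻¹ * (ι b * x - 0#)         ≡⟨ cong (ι b ⁻¹ *_) bx ⟩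
    ι b ⁻¹ * (ι (+ p) ^ j * r)      ≡⟨ solve 3 (λ c π r → c :* (π :* r) := π :* (c :* r))
                                         refl (ι b ⁻¹) (ι (+ p) ^ j) r ⟩
    ι (+ p) ^ j * (ι b ⁻¹ * r)      ∎)
    where
    open ≡-Reasoning
    open +-*-Solver

  ∑-≅ : ∀ {A : Set} j (f g : A → ℚ[i]) xs → (∀ {x} → x ∈ xs → f x ≅ g x [mod p ^ j ]) →
        ∑ (map f xs) ≅ ∑ (map g xs) [mod p ^ j ]
  ∑-≅ j f g []       f≅g = ≅-refl j {0#}
  ∑-≅ j f g (x ∷ xs) f≅g =
    ≅-+ j {f x} {g x} {∑ (map f xs)} {∑ (map g xs)} (f≅g (here refl)) (∑-≅ j f g xs (f≅g ∘ there))

-- The reciprocal sums and their divisibility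

gaussian : ℕ × ℕ → ℚ[i]
gaussian (n , m) = fromℤ[i] ((+ n) +i (+ m))

u : ℕ × ℕ → ℚ[i]
u x = gaussian x ⁻¹

module ReciprocalSums (p : ℕ) (pr : Prime p) (5<p : 5 < p) where

  open IndexSymmetries p pr
  open Localization p pr

  private instance _ = prime⇒nonZero pr

  π : ℚ[i]
  π = ι (+ p)

  π∈R : R p π
  π∈R = R-ℤ[i] ((+ p) +i (+ 0))

  valid⇒∤norm : ∀ {n m} → Valid (n , m) → ¬ (+ p ∣ + n ℤ.* + n ℤ.+ + m ℤ.* + m)
  valid⇒∤norm {n} {m} (_ , _ , p∤N) p∣N = p∤N (subst (+ p ∣_)
    (sym (trans (ℤ.pos-+ (n ℕ.* n) (m ℕ.* m)) (cong₂ ℤ._+_ (ℤ.pos-* n n) (ℤ.pos-* m m)))) p∣N)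

  gaussian-inverse : ∀ {x} → Valid x → gaussian x * u x ≡ 1#
  gaussian-inverse {n , m} v = unit-⁻¹ (+ n) (+ m) (valid⇒∤norm v)

  u∈R : ∀ {x} → Valid x → R p (u x)
  u∈R {n , m} v = R-unit-⁻¹ (+ n) (+ m) (valid⇒∤norm v) (gaussian-inverse v)

  ∑ᵖ : (ℕ × ℕ → ℚ[i]) → ℚ[i]
  ∑ᵖ f = ∑ (map f (indices p))

  -- Unlike in `S`, inversion precedes the power, so that for every k the summands are powers of the
  -- same elements of R and the polynomial relations apply.
  T : ℕ → ℚ[i]
  T k = ∑ᵖ (λ x → u x ^ k)

  S≡T : ∀ k → S p k ≡ T k
  S≡T k = ∑-cong _ (λ x → u x ^ k) (indices p) λ {x} x∈ →
    trans (*-identityˡ _) (⁻¹-unique {gaussian x ^ k} {u x ^ k}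
      (^-inverse {gaussian x} {u x} k (gaussian-inverse (indices⁻ x∈))))

  gaussian-ρ : ∀ {x} → Valid x → gaussian (ρ x) ≡ π + i * gaussian x
  gaussian-ρ {n , m} (_ , (_ , m<p) , _) = begin
    fromℤ[i] ((+ (p ℕ.∸ m)) +i (+ n))                          ≡⟨ cong fromℤ[i] (cong₂ _+i_ re≡ im≡) ⟩
    fromℤ[i] (((+ p) +i (+ 0)) +ᶻ iᶻ *ᶻ z)                     ≡⟨ fromℤ[i]-+ ((+ p) +i (+ 0)) (iᶻ *ᶻ z) ⟩
    π + fromℤ[i] (iᶻ *ᶻ z)                                     ≡⟨ cong (λ s → π + s) (fromℤ[i]-* iᶻ z) ⟩
    π + i * fromℤ[i] z                                         ∎
    where
    open ≡-Reasoning
    iᶻ = (+ 0) +i (+ 1)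
    z  = (+ n) +i (+ m)
    -- Because m < p, the truncated difference is the true one in ℤ.
    p≡ : + p ≡ + (p ℕ.∸ m) ℤ.+ + m
    p≡ = trans (cong +_ (sym (ℕ.m∸n+n≡m (ℕ.<⇒≤ m<p)))) (ℤ.pos-+ (p ℕ.∸ m) m)
    open ℤ.+-*-Solver
    re≡ : + (p ℕ.∸ m) ≡ + p ℤ.+ (+ 0 ℤ.* + n ℤ.- + 1 ℤ.* + m)
    re≡ = trans
      (solve 3 (λ a n m → a := a :+ m :+ (con (+ 0) :* n :- con (+ 1) :* m)) refl (+ (p ℕ.∸ m)) (+ n) (+ m))
      (cong (ℤ._+ (+ 0 ℤ.* + n ℤ.- + 1 ℤ.* + m)) (sym p≡))
    im≡ : + n ≡ + 0 ℤ.+ (+ 0 ℤ.* + m ℤ.+ + 1 ℤ.* + n)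
    im≡ = solve 2 (λ n m → n := con (+ 0) :+ (con (+ 0) :* m :+ con (+ 1) :* n)) refl (+ n) (+ m)

  -- The Gaussian integer t with 2 z = z′ + p t, where z′ has the reduced coordinates.
  quotients : ℕ × ℕ → ℤ[i]
  quotients (n , m) = (+ (2 ℕ.* n ℕ./ p)) +i (+ (2 ℕ.* m ℕ./ p))

  gaussian-double : ∀ x → gaussian (scale 2 x) + π * fromℤ[i] (quotients x) ≡ 2# * gaussian x
  gaussian-double x@(n , m) = begin
    fromℤ[i] z′ + π * fromℤ[i] t                        ≡⟨ cong (λ s → fromℤ[i] z′ + s) (fromℤ[i]-* ((+ p) +i (+ 0)) t) ⟨
    fromℤ[i] z′ + fromℤ[i] (((+ p) +i (+ 0)) *ᶻ t)      ≡⟨ fromℤ[i]-+ z′ (((+ p) +i (+ 0)) *ᶻ t) ⟨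
    fromℤ[i] (z′ +ᶻ ((+ p) +i (+ 0)) *ᶻ t)              ≡⟨ cong fromℤ[i] (cong₂ _+i_ re≡ im≡) ⟩
    fromℤ[i] (((+ 2) +i (+ 0)) *ᶻ z)                    ≡⟨ fromℤ[i]-* ((+ 2) +i (+ 0)) z ⟩
    2# * fromℤ[i] z                                     ∎
    where
    open ≡-Reasoning
    t  = quotients x
    z  = (+ n) +i (+ m)
    z′ = (+ (2 ℕ.* n ℕ.% p)) +i (+ (2 ℕ.* m ℕ.% p))
    division : ∀ n → + 2 ℤ.* + n ≡ + (2 ℕ.* n ℕ.% p) ℤ.+ + (2 ℕ.* n ℕ./ p) ℤ.* + p
    division n = begin
      + 2 ℤ.* + n                                             ≡⟨ ℤ.pos-* 2 n ⟨
      + (2 ℕ.* n)                                             ≡⟨ cong +_ (ℕ.m≡m%n+[m/n]*n (2 ℕ.* n) p) ⟩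
      + (2 ℕ.* n ℕ.% p ℕ.+ 2 ℕ.* n ℕ./ p ℕ.* p)               ≡⟨ ℤ.pos-+ (2 ℕ.* n ℕ.% p) (2 ℕ.* n ℕ./ p ℕ.* p) ⟩
      + (2 ℕ.* n ℕ.% p) ℤ.+ + (2 ℕ.* n ℕ./ p ℕ.* p)
        ≡⟨ cong (λ s → + (2 ℕ.* n ℕ.% p) ℤ.+ s) (ℤ.pos-* (2 ℕ.* n ℕ./ p) p) ⟩
      + (2 ℕ.* n ℕ.% p) ℤ.+ + (2 ℕ.* n ℕ./ p) ℤ.* + p         ∎
    open ℤ.+-*-Solver
    re≡ : + (2 ℕ.* n ℕ.% p) ℤ.+ (+ p ℤ.* + (2 ℕ.* n ℕ./ p) ℤ.- + 0 ℤ.* + (2 ℕ.* m ℕ./ p)) ≡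
          + 2 ℤ.* + n ℤ.- + 0 ℤ.* + m
    re≡ = trans
      (solve 5 (λ a p q r m → a :+ (p :* q :- con (+ 0) :* r) := (a :+ q :* p) :- con (+ 0) :* m) refl
        (+ (2 ℕ.* n ℕ.% p)) (+ p) (+ (2 ℕ.* n ℕ./ p)) (+ (2 ℕ.* m ℕ./ p)) (+ m))
      (cong (ℤ._- + 0 ℤ.* + m) (sym (division n)))
    im≡ : + (2 ℕ.* m ℕ.% p) ℤ.+ (+ p ℤ.* + (2 ℕ.* m ℕ./ p) ℤ.+ + 0 ℤ.* + (2 ℕ.* n ℕ./ p)) ≡
          + 2 ℤ.* + m ℤ.+ + 0 ℤ.* + n
    im≡ = trans
      (solve 5 (λ a p q r m → a :+ (p :* q :+ con (+ 0) :* r) := (a :+ q :* p) :+ con (+ 0) :* m) refl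
        (+ (2 ℕ.* m ℕ.% p)) (+ p) (+ (2 ℕ.* m ℕ./ p)) (+ (2 ℕ.* n ℕ./ p)) (+ n))
      (cong (ℤ._+ + 0 ℤ.* + n) (sym (division m)))

  p∤small : ∀ k .{{_ : ℕ.NonZero k}} → k ℕ.≤ 5 → ¬ (p ℕ.∣ k)
  p∤small k k≤5 = ℕ.>⇒∤ (ℕ.≤-<-trans k≤5 5<p)

  p∤2 : ¬ (+ p ∣ + 2)
  p∤2 = p∤small 2 (ℕ.s≤s (ℕ.s≤s ℕ.z≤n))

  p∤15 : ¬ (+ p ∣ + 15)
  p∤15 p∣15 = [ p∤small 3 (ℕ.s≤s (ℕ.s≤s (ℕ.s≤s ℕ.z≤n))) , p∤small 5 ℕ.≤-refl ]′ (euclidsLemma 3 5 pr p∣15)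

  T₄≅0 : T 4 ≅ 0# [mod p ^ 1 ]
  -- As 15 T - 0 and 16 T - T are the same element, the quotient found for 16 T ≡ T is reused.
  T₄≅0 = ≅0-cancel 1 {+ 15} {T 4} p∤15 (proj₁ 16T≅T , proj₁ (proj₂ 16T≅T) , trans
      (solve 1 (λ t → con (ι (+ 15)) :* t :- con 0# := con 16# :* t :- t) refl (T 4))
      (proj₂ (proj₂ 16T≅T)))
    where
    open +-*-Solver
    δ = scale 2
    h = half (ℕ.<-trans (ℕ.s≤s (ℕ.s≤s (ℕ.s≤s ℕ.z≤n))) 5<p)
    pointwise : ∀ {x} → x ∈ indices p → (16# * u (δ x) ^ 4) ≅ (u x ^ 4) [mod p ^ 1 ]
    -- With v = `u (δ x)`, the difference (2 v)⁴ - u⁴ contains the factor 2 v - u = π t u v. The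
    -- quotient by π is read off from that identity, and the membership proof follows its shape.
    pointwise {x} x∈ = _ , R-* (R-* (R-* (R-* (R-+ (R-^ 2 2v∈R) (R-^ 2 u∈))
        (R-+ 2v∈R u∈)) (R-ℤ[i] (quotients x))) u∈) v∈ ,
      doubled-reciprocal⁴ π (fromℤ[i] (quotients x)) (u x) (u (δ x))
        (double-relation π (fromℤ[i] (quotients x)) (gaussian x) (gaussian (δ x)) (u x) (u (δ x))
          (gaussian-double x) (gaussian-inverse valid) (gaussian-inverse δ-valid))
      where
      valid = indices⁻ x∈
      δ-valid = scale-valid p∤2 valid
      u∈ = u∈R valid
      v∈ = u∈R δ-valid
      2v∈R = R-* (R-ℤ[i] ((+ 2) +i (+ 0))) v∈
    16T≅T : (16# * T 4) ≅ T 4 [mod p ^ 1 ]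
    16T≅T = subst (_≅ T 4 [mod p ^ 1 ])
      (trans (∑-* 16# (λ x → u (δ x) ^ 4) (indices p)) (cong (16# *_)
        (∑-reindex (λ x → u x ^ 4) (scale-↭ {2} {proj₁ h} (proj₂ h)))))
      (∑-≅ 1 (λ x → 16# * u (δ x) ^ 4) (λ x → u x ^ 4) (indices p) pointwise)

  -- Bounds one summed term of the expansion: `c` is its signed binomial coefficient, `d` a power of
  -- i, and the exponents of p add up.
  ≅0-scale : ∀ l j {c d x} → R p c → R p d → x ≅ 0# [mod p ^ j ] →
             (c * π ^ l * (d * x)) ≅ 0# [mod p ^ (l ℕ.+ j) ]
  ≅0-scale l j {c} {d} {x} c∈R d∈R (r , r∈R , x≡) = c * d * r , R-* (R-* c∈R d∈R) r∈R , (begin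
    c * π ^ l * (d * x) - 0#             ≡⟨ solve 4 (λ c π d x → c :* π :* (d :* x) :- con 0# := c :* π :* d :* (x :- con 0#))
                                              refl c (π ^ l) d x ⟩
    c * π ^ l * d * (x - 0#)             ≡⟨ cong (c * π ^ l * d *_) x≡ ⟩
    c * π ^ l * d * (π ^ j * r)          ≡⟨ solve 5 (λ c π d ϖ r → c :* π :* d :* (ϖ :* r) := π :* ϖ :* (c :* d :* r))
                                              refl c (π ^ l) d (π ^ j) r ⟩
    π ^ l * π ^ j * (c * d * r)          ≡⟨ cong (_* (c * d * r)) (^-+ π l j) ⟨
    π ^ (l ℕ.+ j) * (c * d * r)          ∎)
    where
    open ≡-Reasoning
    open +-*-Solver

  -- Strips the last term of an expanded sum once its divisibility is known.
  ≅0-drop : ∀ j {x y} → (x + y) ≅ 0# [mod p ^ j ] → y ≅ 0# [mod p ^ j ] → x ≅ 0# [mod p ^ j ]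
  ≅0-drop j {x} {y} (r , r∈R , x+y≡) (s , s∈R , y≡) = r - s , R-+ r∈R (R-neg s∈R) , (begin
    x - 0#                     ≡⟨ solve 2 (λ x y → x :- con 0# := (x :+ y :- con 0#) :- (y :- con 0#)) refl x y ⟩
    (x + y - 0#) - (y - 0#)    ≡⟨ cong₂ _-_ x+y≡ y≡ ⟩
    π ^ j * r - π ^ j * s      ≡⟨ solve 3 (λ π r s → π :* r :- π :* s := π :* (r :- s)) refl (π ^ j) r s ⟩
    π ^ j * (r - s)            ∎)
    where
    open ≡-Reasoning
    open +-*-Solver

  ∑-ρ : ∀ k → ∑ᵖ (λ x → u (ρ x) ^ k) ≡ T k
  ∑-ρ k = ∑-reindex (λ x → u x ^ k) ρ-↭

  -- Every term of the expansions is written as coefficient · π^l · y^k, even for coefficient 1 or l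
  -- = 0, so that this one rule sums them all into the form that `≅0-scale` handles.
  ∑-term : ∀ c k → ∑ᵖ (λ x → c * (i * u x) ^ k) ≡ c * (i ^ k * T k)
  ∑-term c k = begin
    ∑ᵖ (λ x → c * (i * u x) ^ k)        ≡⟨ ∑-* c (λ x → (i * u x) ^ k) (indices p) ⟩
    c * ∑ᵖ (λ x → (i * u x) ^ k)        ≡⟨ cong (c *_) (∑-cong (λ x → (i * u x) ^ k) (λ x → i ^ k * u x ^ k) (indices p)
                                             λ {x} _ → *-^ i (u x) k) ⟩
    c * ∑ᵖ (λ x → i ^ k * u x ^ k)      ≡⟨ cong (c *_) (∑-* (i ^ k) (λ x → u x ^ k) (indices p)) ⟩
    c * (i ^ k * T k)                   ∎
    where open ≡-Reasoning

  ∑ᵖ-+ : ∀ f g {s t} → ∑ᵖ f ≡ s → ∑ᵖ g ≡ t → ∑ᵖ (λ x → f x + g x) ≡ s + t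
  ∑ᵖ-+ f g f≡ g≡ = trans (∑-+ f g (indices p)) (cong₂ _+_ f≡ g≡)

  ∑ᵖ-≅0 : ∀ j f → (∀ {x} → x ∈ indices p → f x ≅ 0# [mod p ^ j ]) → ∑ᵖ f ≅ 0# [mod p ^ j ]
  ∑ᵖ-≅0 j f f≅0 = subst (∑ᵖ f ≅_[mod p ^ j ]) (∑-0 (indices p)) (∑-≅ j f (λ _ → 0#) (indices p) f≅0)

  module _ {x} (x∈ : x ∈ indices p) where
    private
      valid = indices⁻ x∈
      ρ-valid′ = ρ-valid valid

    reflect : u (ρ x) + i * u x ≡ π * u (ρ x) * (i * u x)
    reflect = reflect-relation π (gaussian x) (u x) (u (ρ x)) (gaussian-inverse valid)
      (trans (cong (_* u (ρ x)) (sym (gaussian-ρ valid))) (gaussian-inverse ρ-valid′))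

    w∈R : R p (u (ρ x))
    w∈R = u∈R ρ-valid′

    y∈R : R p (i * u x)
    y∈R = R-* (R-ℤ[i] ((+ 0) +i (+ 1))) (u∈R valid)

  ℤ∈R : ∀ a → R p (ι a)
  ℤ∈R a = R-ℤ[i] (a +i (+ 0))

  i^∈R : ∀ k → R p (i ^ k)
  i^∈R k = R-^ k (R-ℤ[i] ((+ 0) +i (+ 1)))

  -- With d = 1 ± i, this uses (1 + i) (1 - i) = 2 to invert 1 ± i modulo p.
  ≅0-unit : ∀ j d {x y} → fromℤ[i] d * y ≡ 2# * x → y ≅ 0# [mod p ^ j ] → x ≅ 0# [mod p ^ j ]
  ≅0-unit j d {x} {y} dy≡2x y≅0 = ≅0-cancel j {+ 2} {x} p∤2
    (subst₂ (_≅_[mod p ^ j ]) dy≡2x (zeroʳ (fromℤ[i] d)) (≅-* j {y} {0#} {fromℤ[i] d} (R-ℤ[i] d) y≅0))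

  T₃≅0 : T 3 ≅ 0# [mod p ^ 2 ]
  -- The leading terms combine to (1 + i³) T = (1 - i) T, hence the multiplier 1 + i.
  T₃≅0 = ≅0-unit 2 ((+ 1) +i (+ 1)) {T 3} {T 3 + 1# * π ^ 0 * (i ^ 3 * T 3)}
      (solve 1 (λ t → con (1# + i) :* (t :+ con 1# :* con 1# :* (con (i ^ 3) :* t)) := con 2# :* t) refl (T 3))
      (≅0-drop 2 {T 3 + 1# * π ^ 0 * (i ^ 3 * T 3)} {3# * π ^ 1 * (i ^ 4 * T 4)}
        (subst (_≅ 0# [mod p ^ 2 ]) sum≡ (∑ᵖ-≅0 2 f pointwise))
        (≅0-scale 1 1 {3#} {i ^ 4} {T 4} (ℤ∈R (+ 3)) (i^∈R 4) T₄≅0))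
    where
    open +-*-Solver
    f₁ f : ℕ × ℕ → ℚ[i]
    -- From w³ = -y³ (1 - π y)⁻³ with y = i u: the coefficients are 1 and 3, and the first omitted
    -- term carries π².
    f₁ x = u (ρ x) ^ 3 + 1# * π ^ 0 * (i * u x) ^ 3
    f x  = f₁ x + 3# * π ^ 1 * (i * u x) ^ 4
    sum≡ : ∑ᵖ f ≡ T 3 + 1# * π ^ 0 * (i ^ 3 * T 3) + 3# * π ^ 1 * (i ^ 4 * T 4)
    sum≡ = ∑ᵖ-+ f₁ (λ x → 3# * π ^ 1 * (i * u x) ^ 4)
      (∑ᵖ-+ (λ x → u (ρ x) ^ 3) (λ x → 1# * π ^ 0 * (i * u x) ^ 3) (∑-ρ 3) (∑-term (1# * π ^ 0) 3))
      (∑-term (3# * π ^ 1) 4)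
    pointwise : ∀ {x} → x ∈ indices p → f x ≅ 0# [mod p ^ 2 ]
    pointwise {x} x∈ = _ ,
      R-+ (R-+ (R-* (R-* π∈R (R-^ 3 (y∈R x∈))) (R-^ 3 (w∈R x∈)))
                         (R-* (R-* (ℤ∈R (+ 3)) (R-^ 4 (y∈R x∈))) (w∈R x∈)))
               (R-neg (R-* (R-* (ℤ∈R (+ 3)) (R-^ 3 (y∈R x∈))) (R-^ 2 (w∈R x∈)))) ,
      reflected-reciprocal³ π (i * u x) (u (ρ x)) (reflect x∈)

  T₂≅0 : T 2 ≅ 0# [mod p ^ 3 ]
  -- Here 1 - i² is already 2, so the multiplier is 1.
  T₂≅0 = ≅0-unit 3 ((+ 1) +i (+ 0)) {T 2} {s₁}
      (solve 1 (λ t → con 1# :* (t :+ con (neg 1#) :* con 1# :* (con (i ^ 2) :* t)) := con 2# :* t) refl (T 2))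
      (≅0-drop 3 {s₁} {neg 2# * π ^ 1 * (i ^ 3 * T 3)}
        (≅0-drop 3 {s₂} {neg 3# * π ^ 2 * (i ^ 4 * T 4)}
          (subst (_≅ 0# [mod p ^ 3 ]) sum≡ (∑ᵖ-≅0 3 f pointwise))
          (≅0-scale 2 1 {neg 3#} {i ^ 4} {T 4} (ℤ∈R (ℤ.- (+ 3))) (i^∈R 4) T₄≅0))
        (≅0-scale 1 2 {neg 2#} {i ^ 3} {T 3} (ℤ∈R (ℤ.- (+ 2))) (i^∈R 3) T₃≅0))
    where
    open +-*-Solver
    s₁ s₂ : ℚ[i]
    s₁ = T 2 + neg 1# * π ^ 0 * (i ^ 2 * T 2)
    s₂ = s₁ + neg 2# * π ^ 1 * (i ^ 3 * T 3)
    f₁ f₂ f : ℕ × ℕ → ℚ[i]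
    -- The coefficients 1, 2, 3 are those of (1 - π y)⁻²; they are negative because w² = y² (1 - π
    -- y)⁻² has positive terms, moved here to the side of w².
    f₁ x = u (ρ x) ^ 2 + neg 1# * π ^ 0 * (i * u x) ^ 2
    f₂ x = f₁ x + neg 2# * π ^ 1 * (i * u x) ^ 3
    f x  = f₂ x + neg 3# * π ^ 2 * (i * u x) ^ 4
    sum≡ : ∑ᵖ f ≡ s₂ + neg 3# * π ^ 2 * (i ^ 4 * T 4)
    sum≡ = ∑ᵖ-+ f₂ (λ x → neg 3# * π ^ 2 * (i * u x) ^ 4)
      (∑ᵖ-+ f₁ (λ x → neg 2# * π ^ 1 * (i * u x) ^ 3)
        (∑ᵖ-+ (λ x → u (ρ x) ^ 2) (λ x → neg 1# * π ^ 0 * (i * u x) ^ 2)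
          (∑-ρ 2) (∑-term (neg 1# * π ^ 0) 2))
        (∑-term (neg 2# * π ^ 1) 3))
      (∑-term (neg 3# * π ^ 2) 4)
    pointwise : ∀ {x} → x ∈ indices p → f x ≅ 0# [mod p ^ 3 ]
    pointwise {x} x∈ = _ ,
      R-+ (R-* (R-^ 2 (w∈R x∈)) (R-^ 3 (y∈R x∈)))
               (R-neg (R-* (R-* (ℤ∈R (+ 3)) (w∈R x∈)) (R-^ 4 (y∈R x∈)))) ,
      reflected-reciprocal² π (i * u x) (u (ρ x)) (reflect x∈)

  T₁≅0 : T 1 ≅ 0# [mod p ^ 4 ]
  T₁≅0 = ≅0-unit 4 ((+ 1) +i (ℤ.- (+ 1))) {T 1} {s₁}
      (solve 1 (λ t → con (1# - i) :* (t :+ con 1# :* con 1# :* (con (i ^ 1) :* t)) := con 2# :* t) refl (T 1))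
      -- Each discarded term reaches p⁴ exactly: the exponents of the explicit power of π and of the
      -- known divisibility are 1 + 3, 2 + 2 and 3 + 1.
      (≅0-drop 4 {s₁} {1# * π ^ 1 * (i ^ 2 * T 2)}
        (≅0-drop 4 {s₂} {1# * π ^ 2 * (i ^ 3 * T 3)}
          (≅0-drop 4 {s₃} {1# * π ^ 3 * (i ^ 4 * T 4)}
            (subst (_≅ 0# [mod p ^ 4 ]) sum≡ (∑ᵖ-≅0 4 f pointwise))
            (≅0-scale 3 1 {1#} {i ^ 4} {T 4} (ℤ∈R (+ 1)) (i^∈R 4) T₄≅0))
          (≅0-scale 2 2 {1#} {i ^ 3} {T 3} (ℤ∈R (+ 1)) (i^∈R 3) T₃≅0))
        (≅0-scale 1 3 {1#} {i ^ 2} {T 2} (ℤ∈R (+ 1)) (i^∈R 2) T₂≅0))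
    where
    open +-*-Solver
    s₁ s₂ s₃ : ℚ[i]
    s₁ = T 1 + 1# * π ^ 0 * (i ^ 1 * T 1)
    s₂ = s₁ + 1# * π ^ 1 * (i ^ 2 * T 2)
    s₃ = s₂ + 1# * π ^ 2 * (i ^ 3 * T 3)
    f₁ f₂ f₃ f : ℕ × ℕ → ℚ[i]
    f₁ x = u (ρ x) ^ 1 + 1# * π ^ 0 * (i * u x) ^ 1
    f₂ x = f₁ x + 1# * π ^ 1 * (i * u x) ^ 2
    f₃ x = f₂ x + 1# * π ^ 2 * (i * u x) ^ 3
    f x  = f₃ x + 1# * π ^ 3 * (i * u x) ^ 4
    sum≡ : ∑ᵖ f ≡ s₃ + 1# * π ^ 3 * (i ^ 4 * T 4)
    sum≡ = ∑ᵖ-+ f₃ (λ x → 1# * π ^ 3 * (i * u x) ^ 4)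
      (∑ᵖ-+ f₂ (λ x → 1# * π ^ 2 * (i * u x) ^ 3)
        (∑ᵖ-+ f₁ (λ x → 1# * π ^ 1 * (i * u x) ^ 2)
          (∑ᵖ-+ (λ x → u (ρ x) ^ 1) (λ x → 1# * π ^ 0 * (i * u x) ^ 1)
            (∑-ρ 1) (∑-term (1# * π ^ 0) 1))
          (∑-term (1# * π ^ 1) 2))
        (∑-term (1# * π ^ 2) 3))
      (∑-term (1# * π ^ 3) 4)
    pointwise : ∀ {x} → x ∈ indices p → f x ≅ 0# [mod p ^ 4 ]
    pointwise {x} x∈ = _ , R-* (R-^ 4 (y∈R x∈)) (w∈R x∈) ,
      reflected-reciprocal¹ π (i * u x) (u (ρ x)) (reflect x∈)

theorem2 : (p : ℕ) → Prime p → 5 < p →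
    (S p 1 ≅ 0# [mod p ^ 4 ]) ×
    (S p 2 ≅ 0# [mod p ^ 3 ]) ×
    (S p 3 ≅ 0# [mod p ^ 2 ]) ×
    (S p 4 ≅ 0# [mod p ^ 1 ])
theorem2 p pr 5<p =
  subst (_≅ 0# [mod p ^ 4 ]) (sym (S≡T 1)) (T₁≅0) ,
  subst (_≅ 0# [mod p ^ 3 ]) (sym (S≡T 2)) (T₂≅0) ,
  subst (_≅ 0# [mod p ^ 2 ]) (sym (S≡T 3)) (T₃≅0) ,
  subst (_≅ 0# [mod p ^ 1 ]) (sym (S≡T 4)) (T₄≅0)
  where open ReciprocalSums p pr 5<p
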